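{- Let $G$ be a connected graph with vertices $v_1,\dots,v_n$, and let $k_1,k_2,k_3$ be nonnegative integers with $k_2\neq k_3$. Then \[ \sum_{i=1}^{n} dv(G-v_i,k_1,k_2,k_3)=(n-2-k_1-k_2-k_3)\,dv(G,k_1,k_2,k_3)+(k_1+1)\,dv(G,k_1+1,k_2,k_3)+(k_2+1)\,dv(G,k_1,k_2+1,k_3)+(k_3+1)\,dv(G,k_1,k_2,k_3+1). \]
   Context: All graphs are finite, simple and undirected. $G-v$ denotes the graph obtained from $G$ by deleting vertex $v$ and its incident edges. For a graph $F$ and nonnegative integers $k_1,k_2,k_3$, $dv(F,k_1,k_2,k_3)$ denotes the number of pairs of non-adjacent vertices $x$ and $y$ in $F$ such that exactly $k_1$ vertices are adjacent to both $x$ and $y$, exactly $k_2$ vertices are adjacent to $x$ but not to $y$, and exactly $k_3$ vertices are adjacent to $y$ but not to $x$. -}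

module Defs where

open import Data.Nat using (ℕ; suc; pred)
import Data.Nat as ℕ
open import Data.Fin using (Fin; punchIn; _≟_)
open import Data.List using (length; filter; allFin; cartesianProduct; map)
open import Data.Nat.ListAction using (sum)
open import Data.Product using (_×_; _,_)
open import Level using (0ℓ)
open import Relation.Binary using (Rel; Decidable; Symmetric)
open import Relation.Binary.Construct.Closure.ReflexiveTransitive using (Star)
open import Relation.Binary.PropositionalEquality using (_≡_; _≢_)
open import Relation.Nullary using (¬_)
open import Relation.Nullary.Decidable using (¬?; _×-dec_)
import Relation.Unary as U

record Graph (n : ℕ) : Set₁ where
  infix 4 _~_ _~?_
  field
    _~_      : Rel (Fin n) 0ℓ
    _~?_     : Decidable _~_
    ~-sym    : Symmetric _~_
    ~-irrefl : ∀ x → ¬ (x ~ x)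

open Graph using (~-sym; ~-irrefl)

-- The vertex component excludes the graph with no vertices.
Connected : ∀ {n} → Graph n → Set
Connected {n} G = Fin n × (∀ (x y : Fin n) → Star (Graph._~_ G) x y)

-- The vertices other than v are renumbered by the order-preserving bijection
-- punchIn v from Fin n onto Fin (suc n) minus v.
infixl 6 _-ᵍ_
_-ᵍ_ : ∀ {n} → Graph n → Fin n → Graph (pred n)
_-ᵍ_ {suc n} G v = record
  { _~_      = λ x y → punchIn v x ~ punchIn v y
  ; _~?_     = λ x y → punchIn v x ~? punchIn v y
  ; ~-sym    = ~-sym G
  ; ~-irrefl = λ x → ~-irrefl G (punchIn v x)
  }
  where open Graph G using (_~_; _~?_)

module _ {n : ℕ} (G : Graph n) where
  open Graph G using (_~_; _~?_)

  #both : Fin n → Fin n → ℕ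
  #both x y = length (filter (λ z → (z ~? x) ×-dec (z ~? y)) (allFin n))

  #only : Fin n → Fin n → ℕ
  #only x y = length (filter (λ z → (z ~? x) ×-dec ¬? (z ~? y)) (allFin n))

  HasType : (k₁ k₂ k₃ : ℕ) → U.Pred (Fin n × Fin n) 0ℓ
  HasType k₁ k₂ k₃ (x , y) =
    x ≢ y × ¬ (x ~ y) × #both x y ≡ k₁ × #only x y ≡ k₂ × #only y x ≡ k₃

  hasType? : ∀ k₁ k₂ k₃ → U.Decidable (HasType k₁ k₂ k₃)
  hasType? k₁ k₂ k₃ (x , y) =
    ¬? (x ≟ y) ×-dec ¬? (x ~? y) ×-dec
    (#both x y ℕ.≟ k₁) ×-dec (#only x y ℕ.≟ k₂) ×-dec (#only y x ℕ.≟ k₃)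

  -- Pairs are ordered, as the roles of x and y differ. An unordered count
  -- differs only for k₂ ≡ k₃ (by a factor 2), but such values do occur on the
  -- right-hand side of the sum formula when k₂ and k₃ differ by one, and there
  -- the ordered count is the one needed (the path on 4 vertices with
  -- (k₁, k₂, k₃) = (0, 0, 1) refutes the formula for unordered pairs).
  dv : (k₁ k₂ k₃ : ℕ) → ℕ
  dv k₁ k₂ k₃ =
    length (filter (hasType? k₁ k₂ k₃) (cartesianProduct (allFin n) (allFin n)))

Σᵛ : ∀ {n} → (Fin n → ℕ) → ℕ
Σᵛ {n} f = sum (map f (allFin n))

{-# OPTIONS --safe #-}

-- Double counting of triples (v, x, y) such that (x, y) has type (k₁, k₂, k₃)
-- in G - v.  Such a pair has in G the type (k₁, k₂, k₃) with at most one entry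
-- increased by one, according to how v is attached to x and y.  Conversely a
-- pair of type (k₁+1, k₂, k₃) is obtained from each of its k₁+1 common
-- neighbours, likewise for k₂ and k₃, and a pair of type (k₁, k₂, k₃) survives
-- the deletion of exactly the n-2-k₁-k₂-k₃ vertices that are distinct from
-- and adjacent to neither of x and y.
module Submission where

open import Data.Bool using (Bool; true; false; not; _∧_)
open import Data.Bool.Properties using (∧-zeroʳ)
open import Data.Fin using (Fin; zero; suc; punchIn; _≟_)
open import Data.Fin.Properties using (punchIn-injective; punchInᵢ≢i)
open import Data.Integer using (+_; _+_; _-_; _*_)
import Data.Integer.Properties as ℤ
import Data.Integer.Tactic.RingSolver as ℤ-Solver
open import Data.List using (length; filter; tabulate; cartesianProduct; map; _++_)
open import Data.List.Properties using (filter-++; length-++; map-tabulate)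
open import Data.Nat using (ℕ; zero; suc; _≡ᵇ_)
import Data.Nat as ℕ
import Data.Nat.ListAction as List
import Data.Nat.Properties as ℕ
import Data.Nat.Tactic.RingSolver as ℕ-Solver
open import Data.Product using (_×_; _,_)
open import Data.Vec.Functional using (replicate)
open import Function using (_∘_; id; mk⇔)
open import Relation.Binary.PropositionalEquality using (_≡_; _≢_; refl; sym; trans; cong; cong₂; module ≡-Reasoning)
open import Relation.Nullary using (Dec; yes; no; does; contradiction)
open import Relation.Nullary.Decidable using (¬?; _×-dec_; dec-true; dec-false; does-⇔)
open import Relation.Unary using (Pred; Decidable)
open import Algebra.Properties.Semiring.Sum ℕ.+-*-semiring using (sum; sum-cong-≗; sum-remove; sum-replicate-zero; ∑-distrib-+; ∑-comm; *-distribˡ-sum; *-distribʳ-sum)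
open import Defs

open ≡-Reasoning

-- Indicators

𝟙 : Bool → ℕ
𝟙 true  = 1
𝟙 false = 0

-- A coefficient of an indicator matters only where the condition holds. There the type of the pair
-- fixes its neighbour counts, so sums over vertices can be traded for constants.
𝟙-dec-scale : ∀ {p} {P : Set p} {m n} (P? : Dec P) → (P → m ≡ n) →
              m ℕ.* 𝟙 (does P?) ≡ n ℕ.* 𝟙 (does P?)
𝟙-dec-scale (yes p) m≡n = cong (ℕ._* 1) (m≡n p)
𝟙-dec-scale {m = m} {n} (no _) _ = trans (ℕ.*-zeroʳ m) (sym (ℕ.*-zeroʳ n))

-- Phrased with `_≡ᵇ_` because `does` of `ℕ._≟_` computes to it, so that it can rewrite inside
-- `typeᵇ`.
+-cancelˡ-≡ᵇ : ∀ k {m n} → (k ℕ.+ m ≡ᵇ k ℕ.+ n) ≡ (m ≡ᵇ n)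
+-cancelˡ-≡ᵇ zero    = refl
+-cancelˡ-≡ᵇ (suc k) = +-cancelˡ-≡ᵇ k

-- Finite sums

sum-tabulate : ∀ {n} (f : Fin n → ℕ) → List.sum (tabulate f) ≡ sum f
sum-tabulate {zero}  f = refl
sum-tabulate {suc n} f = cong (f zero ℕ.+_) (sum-tabulate (f ∘ suc))

Σᵛ≡sum : ∀ {n} (f : Fin n → ℕ) → Σᵛ f ≡ sum f
Σᵛ≡sum f = trans (cong List.sum (map-tabulate id f)) (sum-tabulate f)

sum-const-1 : ∀ n → sum (replicate n 1) ≡ n
sum-const-1 zero    = refl
sum-const-1 (suc n) = cong suc (sum-const-1 n)

sum-punchIn : ∀ {n} (f : Fin (suc n) → ℕ) v → f v ≡ 0 → sum (f ∘ punchIn v) ≡ sum f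
sum-punchIn f v fv≡0 =
  sym (trans (sum-remove {i = v} f) (cong (ℕ._+ sum (f ∘ punchIn v)) fv≡0))

sum-𝟙-≟ : ∀ {n} (x : Fin n) → sum (λ v → 𝟙 (does (v ≟ x))) ≡ 1
sum-𝟙-≟ {suc n} x = begin
  sum δ                        ≡⟨ sum-remove {i = x} δ ⟩
  δ x ℕ.+ sum (δ ∘ punchIn x)  ≡⟨ cong₂ ℕ._+_ (cong 𝟙 (dec-true (x ≟ x) refl))
                                    (sum-cong-≗ λ i → cong 𝟙 (dec-false (punchIn x i ≟ x) (punchInᵢ≢i x i))) ⟩
  1 ℕ.+ sum (replicate n 0)    ≡⟨ cong suc (sum-replicate-zero n) ⟩
  1                            ∎
  where
  δ : Fin (suc n) → ℕ
  δ v = 𝟙 (does (v ≟ x))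

sum₂ : ∀ {m n} → (Fin m → Fin n → ℕ) → ℕ
sum₂ f = sum (λ x → sum (f x))

sum₂-cong : ∀ {m n} {f g : Fin m → Fin n → ℕ} → (∀ x y → f x y ≡ g x y) → sum₂ f ≡ sum₂ g
sum₂-cong f≗g = sum-cong-≗ (sum-cong-≗ ∘ f≗g)

sum₂-distrib-+ : ∀ {m n} (f g : Fin m → Fin n → ℕ) →
                 sum₂ (λ x y → f x y ℕ.+ g x y) ≡ sum₂ f ℕ.+ sum₂ g
sum₂-distrib-+ f g =
  trans (sum-cong-≗ λ x → ∑-distrib-+ (f x) (g x)) (∑-distrib-+ (sum ∘ f) (sum ∘ g))

sum₂-distribˡ-* : ∀ {m n} c (f : Fin m → Fin n → ℕ) →
                  sum₂ (λ x y → c ℕ.* f x y) ≡ c ℕ.* sum₂ f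
sum₂-distribˡ-* c f =
  sym (trans (*-distribˡ-sum c (sum ∘ f)) (sum-cong-≗ λ x → *-distribˡ-sum c (f x)))

sum-sum₂-comm : ∀ {l m n} (f : Fin l → Fin m → Fin n → ℕ) →
                sum (λ v → sum₂ (f v)) ≡ sum₂ (λ x y → sum (λ v → f v x y))
sum-sum₂-comm f =
  trans (∑-comm (λ v x → sum (f v x))) (sum-cong-≗ λ x → ∑-comm (λ v → f v x))

-- Restore the zero entry in column `v` of each remaining row, then the row `v`, whose sum is zero.
sum₂-punchIn : ∀ {n} (f : Fin (suc n) → Fin (suc n) → ℕ) v →
               (∀ y → f v y ≡ 0) → (∀ x → f x v ≡ 0) →
               sum₂ (λ x y → f (punchIn v x) (punchIn v y)) ≡ sum₂ f
sum₂-punchIn {n} f v row col = begin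
  sum₂ (λ x y → f (punchIn v x) (punchIn v y))
    ≡⟨ sum-cong-≗ (λ x → sum-punchIn (f (punchIn v x)) v (col (punchIn v x))) ⟩
  sum (λ x → sum (f (punchIn v x)))
    ≡⟨ sum-punchIn (sum ∘ f) v (trans (sum-cong-≗ row) (sum-replicate-zero (suc n))) ⟩
  sum₂ f ∎

-- Cardinalities as sums of indicators

length-filter-tabulate : ∀ {a p} {A : Set a} {P : Pred A p} (P? : Decidable P) {n} (f : Fin n → A) →
  length (filter P? (tabulate f)) ≡ sum (λ i → 𝟙 (does (P? (f i))))
length-filter-tabulate P? {zero}  f = refl
length-filter-tabulate P? {suc n} f with ih ← length-filter-tabulate P? (f ∘ suc) | does (P? (f zero))
... | true  = cong suc ih
... | false = ih

length-filter-cartesianProduct :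
  ∀ {a b p} {A : Set a} {B : Set b} {P : Pred (A × B) p} (P? : Decidable P)
  {m n} (f : Fin m → A) (g : Fin n → B) →
  length (filter P? (cartesianProduct (tabulate f) (tabulate g)))
    ≡ sum₂ (λ i j → 𝟙 (does (P? (f i , g j))))
length-filter-cartesianProduct P? {zero}  f g = refl
length-filter-cartesianProduct P? {suc m} f g = begin
  length (filter P? (row ++ rest))
    ≡⟨ cong length (filter-++ P? row rest) ⟩
  length (filter P? row ++ filter P? rest)
    ≡⟨ length-++ (filter P? row) ⟩
  length (filter P? row) ℕ.+ length (filter P? rest)
    ≡⟨ cong₂ ℕ._+_
         (trans (cong (length ∘ filter P?) (map-tabulate g (f zero ,_)))
                (length-filter-tabulate P? (λ j → f zero , g j)))
         (length-filter-cartesianProduct P? (f ∘ suc) g) ⟩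
  sum₂ (λ i j → 𝟙 (does (P? (f i , g j)))) ∎
  where
  row  = map (f zero ,_) (tabulate g)
  rest = cartesianProduct (tabulate (f ∘ suc)) (tabulate g)

-- Types of pairs of vertices

module _ {n : ℕ} (G : Graph n) where
  open Graph G

  common : Fin n → Fin n → Fin n → Bool
  common v x y = does (v ~? x) ∧ does (v ~? y)

  exclusive : Fin n → Fin n → Fin n → Bool
  exclusive v x y = does (v ~? x) ∧ not (does (v ~? y))

  #both≡sum : ∀ x y → #both G x y ≡ sum (λ v → 𝟙 (common v x y))
  #both≡sum x y = length-filter-tabulate (λ v → (v ~? x) ×-dec (v ~? y)) id

  #only≡sum : ∀ x y → #only G x y ≡ sum (λ v → 𝟙 (exclusive v x y))
  #only≡sum x y = length-filter-tabulate (λ v → (v ~? x) ×-dec ¬? (v ~? y)) id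

  typeᵇ : (k₁ k₂ k₃ : ℕ) → Fin n → Fin n → Bool
  typeᵇ k₁ k₂ k₃ x y = does (hasType? G k₁ k₂ k₃ (x , y))

  dv≡sum₂ : ∀ k₁ k₂ k₃ → dv G k₁ k₂ k₃ ≡ sum₂ (λ x y → 𝟙 (typeᵇ k₁ k₂ k₃ x y))
  dv≡sum₂ k₁ k₂ k₃ = length-filter-cartesianProduct (hasType? G k₁ k₂ k₃) id id

  typeᵇ-diagonal : ∀ k₁ k₂ k₃ x → typeᵇ k₁ k₂ k₃ x x ≡ false
  typeᵇ-diagonal k₁ k₂ k₃ x =
    dec-false (hasType? G k₁ k₂ k₃ (x , x)) λ (x≢x , _) → x≢x refl

  typeᵇ-adjacent : ∀ k₁ k₂ k₃ {x y} → x ~ y → typeᵇ k₁ k₂ k₃ x y ≡ false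
  typeᵇ-adjacent k₁ k₂ k₃ {x} {y} x~y =
    dec-false (hasType? G k₁ k₂ k₃ (x , y)) λ (_ , x≁y , _) → x≁y x~y

  -- The condition, read in G, that v differs from x and y and that (x , y) has
  -- type (k₁ , k₂ , k₃) in G - v.
  survivesᵇ : (k₁ k₂ k₃ : ℕ) → Fin n → Fin n → Fin n → Bool
  survivesᵇ k₁ k₂ k₃ v x y =
    not (does (v ≟ x)) ∧ not (does (v ≟ y)) ∧
    typeᵇ (𝟙 (common v x y) ℕ.+ k₁) (𝟙 (exclusive v x y) ℕ.+ k₂) (𝟙 (exclusive v y x) ℕ.+ k₃) x y

  survivesᵇ-row : ∀ k₁ k₂ k₃ v y → survivesᵇ k₁ k₂ k₃ v v y ≡ false
  survivesᵇ-row k₁ k₂ k₃ v y rewrite dec-true (v ≟ v) refl = refl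

  survivesᵇ-column : ∀ k₁ k₂ k₃ v x → survivesᵇ k₁ k₂ k₃ v x v ≡ false
  survivesᵇ-column k₁ k₂ k₃ v x rewrite dec-true (v ≟ v) refl = ∧-zeroʳ _

  private
    pad : ∀ a → a ≡ a ℕ.+ 0 ℕ.+ 0 ℕ.+ 0
    pad = ℕ-Solver.solve-∀

    swap₁ : ∀ t u → u ℕ.+ 1 ℕ.* t ≡ 1 ℕ.* t ℕ.+ 1 ℕ.* u ℕ.+ 0 ℕ.+ 0
    swap₁ = ℕ-Solver.solve-∀

    swap₂ : ∀ t u → u ℕ.+ 1 ℕ.* t ≡ 1 ℕ.* t ℕ.+ 0 ℕ.+ 1 ℕ.* u ℕ.+ 0
    swap₂ = ℕ-Solver.solve-∀

    swap₃ : ∀ t u → u ℕ.+ 1 ℕ.* t ≡ 1 ℕ.* t ℕ.+ 0 ℕ.+ 0 ℕ.+ 1 ℕ.* u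
    swap₃ = ℕ-Solver.solve-∀

    survive : ∀ t → t ℕ.+ 0 ≡ 1 ℕ.* t ℕ.+ 0 ℕ.+ 0 ℕ.+ 0
    survive = ℕ-Solver.solve-∀

  -- The terms counting the excluded vertices are on the left so that the
  -- identity holds in ℕ.
  survivesᵇ-split : ∀ k₁ k₂ k₃ v x y →
    𝟙 (survivesᵇ k₁ k₂ k₃ v x y)
      ℕ.+ (𝟙 (does (v ≟ x)) ℕ.+ 𝟙 (does (v ≟ y))
           ℕ.+ 𝟙 (common v x y) ℕ.+ 𝟙 (exclusive v x y) ℕ.+ 𝟙 (exclusive v y x))
          ℕ.* 𝟙 (typeᵇ k₁ k₂ k₃ x y)
    ≡ 1 ℕ.* 𝟙 (typeᵇ k₁ k₂ k₃ x y)
      ℕ.+ 𝟙 (common v x y) ℕ.* 𝟙 (typeᵇ (suc k₁) k₂ k₃ x y)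
      ℕ.+ 𝟙 (exclusive v x y) ℕ.* 𝟙 (typeᵇ k₁ (suc k₂) k₃ x y)
      ℕ.+ 𝟙 (exclusive v y x) ℕ.* 𝟙 (typeᵇ k₁ k₂ (suc k₃) x y)
  survivesᵇ-split k₁ k₂ k₃ v x y with v ≟ x | v ≟ y | v ~? x | v ~? y
  ... | yes refl | _        | yes v~v | _       = contradiction v~v (~-irrefl v)
  ... | _        | yes refl | _       | yes v~v = contradiction v~v (~-irrefl v)
  -- `v` is excluded twice here, but a diagonal pair has no type, so both sides vanish.
  ... | yes refl | yes refl | no _    | no _
    rewrite typeᵇ-diagonal k₁ k₂ k₃ v = refl
  -- `v` is excluded both as an endpoint and as a neighbour of `y`. This does no harm, since
  -- adjacent pairs have no type.
  ... | yes refl | no _     | no _    | yes v~y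
    rewrite typeᵇ-adjacent k₁ k₂ k₃ v~y | typeᵇ-adjacent k₁ k₂ (suc k₃) v~y = refl
  ... | yes refl | no _     | no _    | no _    = pad (1 ℕ.* 𝟙 (typeᵇ k₁ k₂ k₃ v y))
  ... | no _     | yes refl | yes v~x | no _
    rewrite typeᵇ-adjacent k₁ k₂ k₃ (~-sym v~x) | typeᵇ-adjacent k₁ (suc k₂) k₃ (~-sym v~x) = refl
  ... | no _     | yes refl | no _    | no _    = pad (1 ℕ.* 𝟙 (typeᵇ k₁ k₂ k₃ x v))
  -- From here on `v` is not an endpoint. If it is adjacent to one, `t` is its excluded term and `u`
  -- the indicator of the type with one entry raised, which is what survival of the pair amounts to.
  ... | no _     | no _     | yes _   | yes _   = swap₁ (𝟙 (typeᵇ k₁ k₂ k₃ x y)) (𝟙 (typeᵇ (suc k₁) k₂ k₃ x y))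
  ... | no _     | no _     | yes _   | no _    = swap₂ (𝟙 (typeᵇ k₁ k₂ k₃ x y)) (𝟙 (typeᵇ k₁ (suc k₂) k₃ x y))
  ... | no _     | no _     | no _    | yes _   = swap₃ (𝟙 (typeᵇ k₁ k₂ k₃ x y)) (𝟙 (typeᵇ k₁ k₂ (suc k₃) x y))
  ... | no _     | no _     | no _    | no _    = survive (𝟙 (typeᵇ k₁ k₂ k₃ x y))

  -- `survivesᵇ-split` summed over `v` for a fixed pair: each raised type is reached once for every
  -- neighbour of the corresponding kind.
  sum-survivesᵇ : ∀ k₁ k₂ k₃ x y →
    sum (λ v → 𝟙 (survivesᵇ k₁ k₂ k₃ v x y)) ℕ.+ (2 ℕ.+ k₁ ℕ.+ k₂ ℕ.+ k₃) ℕ.* 𝟙 (typeᵇ k₁ k₂ k₃ x y)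
    ≡ n ℕ.* 𝟙 (typeᵇ k₁ k₂ k₃ x y)
      ℕ.+ suc k₁ ℕ.* 𝟙 (typeᵇ (suc k₁) k₂ k₃ x y)
      ℕ.+ suc k₂ ℕ.* 𝟙 (typeᵇ k₁ (suc k₂) k₃ x y)
      ℕ.+ suc k₃ ℕ.* 𝟙 (typeᵇ k₁ k₂ (suc k₃) x y)
  sum-survivesᵇ k₁ k₂ k₃ x y = begin
    sum s ℕ.+ (2 ℕ.+ k₁ ℕ.+ k₂ ℕ.+ k₃) ℕ.* t
      -- The number of excluded vertices is known only for a pair of type `(k₁ , k₂ , k₃)`, but it
      -- is multiplied by the indicator `t` of that type.
      ≡⟨ cong (sum s ℕ.+_) (𝟙-dec-scale (hasType? G k₁ k₂ k₃ (x , y)) excluded) ⟨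
    sum s ℕ.+ sum e ℕ.* t
      ≡⟨ cong (sum s ℕ.+_) (*-distribʳ-sum t e) ⟩
    sum s ℕ.+ sum (λ v → e v ℕ.* t)
      ≡⟨ ∑-distrib-+ s (λ v → e v ℕ.* t) ⟨
    sum (λ v → s v ℕ.+ e v ℕ.* t)
      ≡⟨ sum-cong-≗ (λ v → survivesᵇ-split k₁ k₂ k₃ v x y) ⟩
    sum (λ v → 1 ℕ.* t ℕ.+ c v ℕ.* t₁ ℕ.+ p v ℕ.* t₂ ℕ.+ q v ℕ.* t₃)
      ≡⟨ trans (∑-distrib-+ (λ v → 1 ℕ.* t ℕ.+ c v ℕ.* t₁ ℕ.+ p v ℕ.* t₂) (λ v → q v ℕ.* t₃))
           (cong (ℕ._+ sum (λ v → q v ℕ.* t₃))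
             (trans (∑-distrib-+ (λ v → 1 ℕ.* t ℕ.+ c v ℕ.* t₁) (λ v → p v ℕ.* t₂))
               (cong (ℕ._+ sum (λ v → p v ℕ.* t₂))
                 (∑-distrib-+ (λ _ → 1 ℕ.* t) (λ v → c v ℕ.* t₁))))) ⟩
    sum {n} (λ _ → 1 ℕ.* t) ℕ.+ sum (λ v → c v ℕ.* t₁) ℕ.+ sum (λ v → p v ℕ.* t₂) ℕ.+ sum (λ v → q v ℕ.* t₃)
      ≡⟨ plus (*-distribʳ-sum t (replicate n 1)) (*-distribʳ-sum t₁ c) (*-distribʳ-sum t₂ p) (*-distribʳ-sum t₃ q) ⟨
    sum (replicate n 1) ℕ.* t ℕ.+ sum c ℕ.* t₁ ℕ.+ sum p ℕ.* t₂ ℕ.+ sum q ℕ.* t₃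
      -- Each neighbour count is evaluated under its own raised type, hence the factors `suc k₁`,
      -- `suc k₂` and `suc k₃`.
      ≡⟨ plus (cong (ℕ._* t) (sum-const-1 n))
              (𝟙-dec-scale (hasType? G (suc k₁) k₂ k₃ (x , y)) λ (_ , _ , b≡ , _) → trans (sym (#both≡sum x y)) b≡)
              (𝟙-dec-scale (hasType? G k₁ (suc k₂) k₃ (x , y)) λ (_ , _ , _ , o≡ , _) → trans (sym (#only≡sum x y)) o≡)
              (𝟙-dec-scale (hasType? G k₁ k₂ (suc k₃) (x , y)) λ (_ , _ , _ , _ , o≡) → trans (sym (#only≡sum y x)) o≡) ⟩
    n ℕ.* t ℕ.+ suc k₁ ℕ.* t₁ ℕ.+ suc k₂ ℕ.* t₂ ℕ.+ suc k₃ ℕ.* t₃ ∎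
    where
    t  = 𝟙 (typeᵇ k₁ k₂ k₃ x y)
    t₁ = 𝟙 (typeᵇ (suc k₁) k₂ k₃ x y)
    t₂ = 𝟙 (typeᵇ k₁ (suc k₂) k₃ x y)
    t₃ = 𝟙 (typeᵇ k₁ k₂ (suc k₃) x y)

    s δx δy c p q e : Fin n → ℕ
    s  v = 𝟙 (survivesᵇ k₁ k₂ k₃ v x y)
    δx v = 𝟙 (does (v ≟ x))
    δy v = 𝟙 (does (v ≟ y))
    c  v = 𝟙 (common v x y)
    p  v = 𝟙 (exclusive v x y)
    q  v = 𝟙 (exclusive v y x)
    e  v = δx v ℕ.+ δy v ℕ.+ c v ℕ.+ p v ℕ.+ q v

    plus : ∀ {a a′ b b′ d d′ f f′} → a ≡ a′ → b ≡ b′ → d ≡ d′ → f ≡ f′ →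
           a ℕ.+ b ℕ.+ d ℕ.+ f ≡ a′ ℕ.+ b′ ℕ.+ d′ ℕ.+ f′
    plus refl refl refl refl = refl

    sum-e : sum e ≡ 2 ℕ.+ sum c ℕ.+ sum p ℕ.+ sum q
    sum-e = begin
      sum e
        ≡⟨ ∑-distrib-+ (λ v → δx v ℕ.+ δy v ℕ.+ c v ℕ.+ p v) q ⟩
      sum (λ v → δx v ℕ.+ δy v ℕ.+ c v ℕ.+ p v) ℕ.+ sum q
        ≡⟨ cong (ℕ._+ sum q) (∑-distrib-+ (λ v → δx v ℕ.+ δy v ℕ.+ c v) p) ⟩
      sum (λ v → δx v ℕ.+ δy v ℕ.+ c v) ℕ.+ sum p ℕ.+ sum q
        ≡⟨ cong (λ a → a ℕ.+ sum p ℕ.+ sum q) (∑-distrib-+ (λ v → δx v ℕ.+ δy v) c) ⟩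
      sum (λ v → δx v ℕ.+ δy v) ℕ.+ sum c ℕ.+ sum p ℕ.+ sum q
        -- The 2 stands for the endpoints `x` and `y`, each met by exactly one `v`.
        ≡⟨ cong (λ a → a ℕ.+ sum c ℕ.+ sum p ℕ.+ sum q)
             (trans (∑-distrib-+ δx δy) (cong₂ ℕ._+_ (sum-𝟙-≟ x) (sum-𝟙-≟ y))) ⟩
      2 ℕ.+ sum c ℕ.+ sum p ℕ.+ sum q ∎

    excluded : HasType G k₁ k₂ k₃ (x , y) → sum e ≡ 2 ℕ.+ k₁ ℕ.+ k₂ ℕ.+ k₃
    excluded (_ , _ , b≡ , o≡ , o′≡) = trans sum-e
      (plus refl (trans (sym (#both≡sum x y)) b≡)
                 (trans (sym (#only≡sum x y)) o≡)
                 (trans (sym (#only≡sum y x)) o′≡))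

-- Vertex deletion

module _ {m : ℕ} (G : Graph (suc m)) (v : Fin (suc m)) where

  #both-delete : ∀ x y → let x′ = punchIn v x; y′ = punchIn v y in
    #both G x′ y′ ≡ 𝟙 (common G v x′ y′) ℕ.+ #both (G -ᵍ v) x y
  #both-delete x y = begin
    #both G x′ y′                                    ≡⟨ #both≡sum G x′ y′ ⟩
    sum (λ z → 𝟙 (common G z x′ y′))                 ≡⟨ sum-remove {i = v} (λ z → 𝟙 (common G z x′ y′)) ⟩
    -- The terms left by `sum-remove` are taken at `punchIn v z`, which is by definition adjacency
    -- in `G -ᵍ v`.
    𝟙 (common G v x′ y′) ℕ.+ sum (λ z → 𝟙 (common (G -ᵍ v) z x y))
                                                     ≡⟨ cong (𝟙 (common G v x′ y′) ℕ.+_) (#both≡sum (G -ᵍ v) x y) ⟨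
    𝟙 (common G v x′ y′) ℕ.+ #both (G -ᵍ v) x y      ∎
    where
    x′ = punchIn v x
    y′ = punchIn v y

  #only-delete : ∀ x y → let x′ = punchIn v x; y′ = punchIn v y in
    #only G x′ y′ ≡ 𝟙 (exclusive G v x′ y′) ℕ.+ #only (G -ᵍ v) x y
  #only-delete x y = begin
    #only G x′ y′                                    ≡⟨ #only≡sum G x′ y′ ⟩
    sum (λ z → 𝟙 (exclusive G z x′ y′))              ≡⟨ sum-remove {i = v} (λ z → 𝟙 (exclusive G z x′ y′)) ⟩
    𝟙 (exclusive G v x′ y′) ℕ.+ sum (λ z → 𝟙 (exclusive (G -ᵍ v) z x y))
                                                     ≡⟨ cong (𝟙 (exclusive G v x′ y′) ℕ.+_) (#only≡sum (G -ᵍ v) x y) ⟨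
    𝟙 (exclusive G v x′ y′) ℕ.+ #only (G -ᵍ v) x y   ∎
    where
    x′ = punchIn v x
    y′ = punchIn v y

  -- Deleting `v` lowers each of the three counts by the contribution of `v`, exactly what
  -- `survivesᵇ` adds to the prescribed value, so the contributions cancel.
  typeᵇ-delete : ∀ k₁ k₂ k₃ x y →
    typeᵇ (G -ᵍ v) k₁ k₂ k₃ x y ≡ survivesᵇ G k₁ k₂ k₃ v (punchIn v x) (punchIn v y)
  typeᵇ-delete k₁ k₂ k₃ x y
    rewrite dec-false (v ≟ punchIn v x) (punchInᵢ≢i v x ∘ sym)
          | dec-false (v ≟ punchIn v y) (punchInᵢ≢i v y ∘ sym)
          | #both-delete x y | #only-delete x y | #only-delete y x
          | +-cancelˡ-≡ᵇ (𝟙 (common G v (punchIn v x) (punchIn v y))) {#both (G -ᵍ v) x y} {k₁}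
          | +-cancelˡ-≡ᵇ (𝟙 (exclusive G v (punchIn v x) (punchIn v y))) {#only (G -ᵍ v) x y} {k₂}
          | +-cancelˡ-≡ᵇ (𝟙 (exclusive G v (punchIn v y) (punchIn v x))) {#only (G -ᵍ v) y x} {k₃}
          -- Only the distinctness tests still differ; they agree because `punchIn v` is injective.
          -- The adjacency tests agree by definition.
          | does-⇔ (mk⇔ (cong (punchIn v)) (punchIn-injective v x y)) (x ≟ y) (punchIn v x ≟ punchIn v y)
    = refl

  -- Pairs containing `v` never survive, so the sum may run over all pairs of `G`. Its range then no
  -- longer depends on `v`, as the exchange of summations requires.
  dv-delete : ∀ k₁ k₂ k₃ → dv (G -ᵍ v) k₁ k₂ k₃ ≡ sum₂ (λ x y → 𝟙 (survivesᵇ G k₁ k₂ k₃ v x y))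
  dv-delete k₁ k₂ k₃ = begin
    dv (G -ᵍ v) k₁ k₂ k₃
      ≡⟨ dv≡sum₂ (G -ᵍ v) k₁ k₂ k₃ ⟩
    sum₂ (λ x y → 𝟙 (typeᵇ (G -ᵍ v) k₁ k₂ k₃ x y))
      ≡⟨ sum₂-cong (λ x y → cong 𝟙 (typeᵇ-delete k₁ k₂ k₃ x y)) ⟩
    sum₂ (λ x y → 𝟙 (survivesᵇ G k₁ k₂ k₃ v (punchIn v x) (punchIn v y)))
      ≡⟨ sum₂-punchIn (λ x y → 𝟙 (survivesᵇ G k₁ k₂ k₃ v x y)) v
           (cong 𝟙 ∘ survivesᵇ-row G k₁ k₂ k₃ v) (cong 𝟙 ∘ survivesᵇ-column G k₁ k₂ k₃ v) ⟩
    sum₂ (λ x y → 𝟙 (survivesᵇ G k₁ k₂ k₃ v x y)) ∎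

-- Double counting over vertices and pairs

Σᵛ-dv-delete : ∀ {m} (G : Graph (suc m)) k₁ k₂ k₃ →
  Σᵛ (λ v → dv (G -ᵍ v) k₁ k₂ k₃) ℕ.+ (2 ℕ.+ k₁ ℕ.+ k₂ ℕ.+ k₃) ℕ.* dv G k₁ k₂ k₃
  ≡ suc m ℕ.* dv G k₁ k₂ k₃
    ℕ.+ suc k₁ ℕ.* dv G (suc k₁) k₂ k₃
    ℕ.+ suc k₂ ℕ.* dv G k₁ (suc k₂) k₃
    ℕ.+ suc k₃ ℕ.* dv G k₁ k₂ (suc k₃)
Σᵛ-dv-delete {m} G k₁ k₂ k₃ = begin
  Σᵛ (λ v → dv (G -ᵍ v) k₁ k₂ k₃) ℕ.+ κ ℕ.* dv G k₁ k₂ k₃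
    ≡⟨ cong₂ ℕ._+_ lhs (scaled κ k₁ k₂ k₃) ⟩
  sum₂ S ℕ.+ sum₂ (λ x y → κ ℕ.* t k₁ k₂ k₃ x y)
    ≡⟨ sum₂-distrib-+ S (λ x y → κ ℕ.* t k₁ k₂ k₃ x y) ⟨
  sum₂ (λ x y → S x y ℕ.+ κ ℕ.* t k₁ k₂ k₃ x y)
    ≡⟨ sum₂-cong (sum-survivesᵇ G k₁ k₂ k₃) ⟩
  sum₂ (λ x y → T₀ x y ℕ.+ T₁ x y ℕ.+ T₂ x y ℕ.+ T₃ x y)
    ≡⟨ sum₂-distrib-+ (λ x y → T₀ x y ℕ.+ T₁ x y ℕ.+ T₂ x y) T₃ ⟩
  sum₂ (λ x y → T₀ x y ℕ.+ T₁ x y ℕ.+ T₂ x y) ℕ.+ sum₂ T₃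
    ≡⟨ cong (ℕ._+ sum₂ T₃) (sum₂-distrib-+ (λ x y → T₀ x y ℕ.+ T₁ x y) T₂) ⟩
  sum₂ (λ x y → T₀ x y ℕ.+ T₁ x y) ℕ.+ sum₂ T₂ ℕ.+ sum₂ T₃
    ≡⟨ cong (λ a → a ℕ.+ sum₂ T₂ ℕ.+ sum₂ T₃) (sum₂-distrib-+ T₀ T₁) ⟩
  sum₂ T₀ ℕ.+ sum₂ T₁ ℕ.+ sum₂ T₂ ℕ.+ sum₂ T₃
    ≡⟨ cong₂ ℕ._+_ (cong₂ ℕ._+_ (cong₂ ℕ._+_ (scaled (suc m) k₁ k₂ k₃)
         (scaled (suc k₁) (suc k₁) k₂ k₃)) (scaled (suc k₂) k₁ (suc k₂) k₃)) (scaled (suc k₃) k₁ k₂ (suc k₃)) ⟨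
  suc m ℕ.* dv G k₁ k₂ k₃ ℕ.+ suc k₁ ℕ.* dv G (suc k₁) k₂ k₃
    ℕ.+ suc k₂ ℕ.* dv G k₁ (suc k₂) k₃ ℕ.+ suc k₃ ℕ.* dv G k₁ k₂ (suc k₃) ∎
  where
  κ = 2 ℕ.+ k₁ ℕ.+ k₂ ℕ.+ k₃

  t : (k₁ k₂ k₃ : ℕ) → Fin (suc m) → Fin (suc m) → ℕ
  t k₁ k₂ k₃ x y = 𝟙 (typeᵇ G k₁ k₂ k₃ x y)

  S T₀ T₁ T₂ T₃ : Fin (suc m) → Fin (suc m) → ℕ
  S  x y = sum (λ v → 𝟙 (survivesᵇ G k₁ k₂ k₃ v x y))
  T₀ x y = suc m ℕ.* t k₁ k₂ k₃ x y
  T₁ x y = suc k₁ ℕ.* t (suc k₁) k₂ k₃ x y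
  T₂ x y = suc k₂ ℕ.* t k₁ (suc k₂) k₃ x y
  T₃ x y = suc k₃ ℕ.* t k₁ k₂ (suc k₃) x y

  scaled : ∀ c k₁ k₂ k₃ → c ℕ.* dv G k₁ k₂ k₃ ≡ sum₂ (λ x y → c ℕ.* t k₁ k₂ k₃ x y)
  scaled c k₁ k₂ k₃ =
    trans (cong (c ℕ.*_) (dv≡sum₂ G k₁ k₂ k₃)) (sym (sum₂-distribˡ-* c (t k₁ k₂ k₃)))

  lhs : Σᵛ (λ v → dv (G -ᵍ v) k₁ k₂ k₃) ≡ sum₂ S
  lhs = begin
    Σᵛ (λ v → dv (G -ᵍ v) k₁ k₂ k₃)
      ≡⟨ Σᵛ≡sum (λ v → dv (G -ᵍ v) k₁ k₂ k₃) ⟩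
    sum (λ v → dv (G -ᵍ v) k₁ k₂ k₃)
      ≡⟨ sum-cong-≗ (λ v → dv-delete G v k₁ k₂ k₃) ⟩
    sum (λ v → sum₂ (λ x y → 𝟙 (survivesᵇ G k₁ k₂ k₃ v x y)))
      -- The exchange at the heart of the double count: from pairs per deleted vertex to deleted
      -- vertices per pair.
      ≡⟨ sum-sum₂-comm (λ v x y → 𝟙 (survivesᵇ G k₁ k₂ k₃ v x y)) ⟩
    sum₂ S ∎

-- Passage to the integers

theorem13 : (n : ℕ) (G : Graph n) → Connected G →
    (k₁ k₂ k₃ : ℕ) → k₂ ≢ k₃ →
    + (Σᵛ (λ v → dv (G -ᵍ v) k₁ k₂ k₃))
    ≡ (+ n - + 2 - + k₁ - + k₂ - + k₃) * + dv G k₁ k₂ k₃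
    + + (suc k₁) * + dv G (suc k₁) k₂ k₃
    + + (suc k₂) * + dv G k₁ (suc k₂) k₃
    + + (suc k₃) * + dv G k₁ k₂ (suc k₃)
-- Connectedness supplies a vertex, and there is none in `Fin zero`.
theorem13 zero    G (() , _)
theorem13 (suc m) G _ k₁ k₂ k₃ _ = begin
  + A
    -- Adding and subtracting the excluded term makes the identity in ℕ applicable; the coefficient
    -- of `D` in the goal may be negative.
    ≡⟨ cancel (+ A) (+ κ * + D) ⟩
  + A + + κ * + D - + κ * + D
    ≡⟨ cong (λ a → + A + a - + κ * + D) (ℤ.pos-* κ D) ⟨
  + (A ℕ.+ κ ℕ.* D) - + κ * + D
    ≡⟨ cong (λ a → + a - + κ * + D) (Σᵛ-dv-delete G k₁ k₂ k₃) ⟩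
  + (suc m ℕ.* D ℕ.+ suc k₁ ℕ.* D₁ ℕ.+ suc k₂ ℕ.* D₂ ℕ.+ suc k₃ ℕ.* D₃) - + κ * + D
    -- Only products need `ℤ.pos-*`: sums of nonnegative integers compute, which also unfolds `+ κ`.
    ≡⟨ cong (_- + κ * + D) (cong₂ _+_ (cong₂ _+_ (cong₂ _+_
         (ℤ.pos-* (suc m) D) (ℤ.pos-* (suc k₁) D₁)) (ℤ.pos-* (suc k₂) D₂)) (ℤ.pos-* (suc k₃) D₃)) ⟩
  + suc m * + D + + suc k₁ * + D₁ + + suc k₂ * + D₂ + + suc k₃ * + D₃ - (+ 2 + + k₁ + + k₂ + + k₃) * + D
    ≡⟨ collect (+ suc m) (+ 2) (+ k₁) (+ k₂) (+ k₃) (+ D) (+ suc k₁ * + D₁) (+ suc k₂ * + D₂) (+ suc k₃ * + D₃) ⟩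
  (+ suc m - + 2 - + k₁ - + k₂ - + k₃) * + D + + suc k₁ * + D₁ + + suc k₂ * + D₂ + + suc k₃ * + D₃ ∎
  where
  κ  = 2 ℕ.+ k₁ ℕ.+ k₂ ℕ.+ k₃
  A  = Σᵛ (λ v → dv (G -ᵍ v) k₁ k₂ k₃)
  D  = dv G k₁ k₂ k₃
  D₁ = dv G (suc k₁) k₂ k₃
  D₂ = dv G k₁ (suc k₂) k₃
  D₃ = dv G k₁ k₂ (suc k₃)

  cancel : ∀ a b → a ≡ a + b - b
  cancel = ℤ-Solver.solve-∀

  collect : ∀ n c i j k d x y z →
            n * d + x + y + z - (c + i + j + k) * d ≡ (n - c - i - j - k) * d + x + y + z
  collect = ℤ-Solver.solve-∀
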